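{- For every (deterministic) treasure hunt algorithm $\mathcal{A}$ (in any of the unrestricted, fuel-restricted or rope-restricted models), for every integer $d>1$, for every integer $m\ge d$ and for every integer $x$ with $m\le x\le m^2$, there exists a graph $\mathcal{G}$ with a source node $s$, of radius $d$, such that the ball $B_d(\mathcal{G},s)$ has $\Theta(m)$ nodes and $\Theta(x)$ edges, and the cost incurred by $\mathcal{A}$ to find the treasure located at some node at distance at most $d$ from $s$ in $\mathcal{G}$ is at least $e(d,\mathcal{G})-1$. Here the constants hidden in the $\Theta$ notation are absolute (independent of $\mathcal{A}$, $d$, $m$, $x$).
   Context: Unrestricted model. The graph $\mathcal{G}$ is simple, connected, undirected and locally finite. Nodes have distinct labels that are positive integers. Each edge has a port number at each of its extremities: the ports at a node of degree $\delta$ are numbered $0,1,\dots,\delta-1$ in an arbitrary way. A mobile agent with unbounded memory starts at the source node $s$; at the beginning it sees the label and degree of $s$. The agent executes a deterministic algorithm: at each step it selects a port number at its current node on the basis of all the information it has gathered so far, and traverses the corresponding edge. When it enters the adjacent node, it learns the label of this node, its degree, and the port number by which it has entered. Restricted models (for finite graphs and a fixed real constant $\alpha>0$; $r$ is the radius of the graph). Fuel-restricted: the agent has a fuel tank, of size $2(1+\alpha)r$, that can be replenished only at $s$, so that it can make at most $\lfloor 2(1+\alpha)r\rfloor$ edge traversals between two consecutive visits at $s$. Rope-restricted: the agent is attached to $s$ by a rope that it unwinds by a length of 1 with every forward edge traversal and rewinds by a length of 1 with every backward edge traversal, backward traversals undoing forward traversals in a first-in last-out stack order; the unwound segment must never be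 longer than $(1+\alpha)r$. Treasure hunt. An inert treasure is hidden by an adversary in some node of the graph; the agent finds it when it visits this node. The agent has no a priori knowledge of the graph, of the location of the treasure, or of its distance from $s$. A treasure hunt algorithm is a deterministic algorithm that, in every graph of the model, for every source node and every location of the treasure, makes the agent find the treasure. The cost is the number of edge traversals performed by the agent until finding the treasure. Notation. The radius of the graph $\mathcal{G}$ with source node $s$ is the maximum distance of a node from $s$. The ball $B_k(\mathcal{G},s)$ is the subgraph of $\mathcal{G}$ whose nodes are all nodes at distance at most $k$ from $s$ and whose edges are all edges of $\mathcal{G}$ with at least one extremity at distance smaller than $k$ from $s$. The number of edges of $B_k(\mathcal{G},s)$ is denoted by $e(k,\mathcal{G})$. -}

module Defs where

open import Data.Bool using (if_then_else_)
open import Data.Fin using (Fin; toℕ)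
open import Data.Integer as ℤ using ()
open import Data.List using (List; []; _∷_; length)
open import Data.List.Membership.Propositional using (_∈_; _∉_)
open import Data.List.Relation.Unary.Unique.Propositional using (Unique)
open import Data.Nat as ℕ using (ℕ; suc; _*_; _≤_; _<_)
open import Data.Product using (Σ; ∃; ∃-syntax; _×_; _,_; proj₁; proj₂)
open import Data.Rational as ℚ using (ℚ; 0ℚ; 1ℚ)
open import Data.Sum using (_⊎_)
open import Data.Unit using (⊤)
open import Function.Bundles using (_⇔_)
open import Function.Definitions using (Injective)
open import Relation.Binary.Construct.Closure.ReflexiveTransitive using (Star)
open import Relation.Binary.PropositionalEquality using (_≡_; _≢_; cong)
open import Relation.Nullary using (¬_; Dec; does)
open import Relation.Nullary.Decidable using (map′)

-- Dedekind real numbers: lower q means q < α, upper q means α < q.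
record ℝ : Set₁ where
  field
    lower upper     : ℚ → Set
    lower-inhabited : ∃ lower
    upper-inhabited : ∃ upper
    lower-rounded   : ∀ q → lower q ⇔ (∃[ r ] q ℚ.< r × lower r)
    upper-rounded   : ∀ q → upper q ⇔ (∃[ r ] r ℚ.< q × upper r)
    disjoint        : ∀ q → ¬ (lower q × upper q)
    located         : ∀ q r → q ℚ.< r → lower q ⊎ upper r

Positive : ℝ → Set
Positive α = ℝ.lower α 0ℚ

fromℕ : ℕ → ℚ
fromℕ n = ℤ.+ n ℚ./ 1

-- n ≤ c (1 + α) r, the right-hand side being the infimum of c (1 + q) r over
-- the rationals q > α.  For a natural number n this is also n ≤ ⌊c (1 + α) r⌋.
AtMost[_⟨1+_⟩_] : ℕ → ℝ → ℕ → ℕ → Set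
AtMost[ c ⟨1+ α ⟩ r ] n =
  ∀ q → ℝ.upper α q → fromℕ n ℚ.≤ fromℕ c ℚ.* (1ℚ ℚ.+ q) ℚ.* fromℕ r

-- A dart (v , p) is the extremity, carrying port p, of an edge at v.  The other
-- extremity of that edge is opp (v , p), so edges are the orbits of opp.  Node
-- may be infinite; local finiteness is built into deg.
record Graph : Set₁ where
  field
    Node            : Set
    label           : Node → ℕ
    label-positive  : ∀ v → 0 < label v
    label-injective : Injective _≡_ _≡_ label
    deg             : Node → ℕ

  Dart : Set
  Dart = Σ Node λ v → Fin (deg v)

  field
    opp            : Dart → Dart
    opp-involutive : ∀ e → opp (opp e) ≡ e

  target : (v : Node) → Fin (deg v) → Node
  target v p = proj₁ (opp (v , p))

  entry : (v : Node) (p : Fin (deg v)) → Fin (deg (target v p))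
  entry v p = proj₂ (opp (v , p))

  Adjacent : Node → Node → Set
  Adjacent u v = ∃[ p ] target u p ≡ v

  field
    no-loops          : ∀ v p → target v p ≢ v
    no-multiple-edges : ∀ v p q → target v p ≡ target v q → p ≡ q
    connected         : ∀ u v → Star Adjacent u v

  _≟_ : (u v : Node) → Dec (u ≡ v)
  u ≟ v = map′ label-injective (cong label) (label u ℕ.≟ label v)

HasCardinality : {A : Set} → (A → Set) → ℕ → Set
HasCardinality {A} P n =
  Σ (List A) λ xs → Unique xs × (∀ a → a ∈ xs ⇔ P a) × length xs ≡ n

Finite : Graph → Set
Finite G = ∃[ n ] HasCardinality {Graph.Node G} (λ _ → ⊤) n

module _ (G : Graph) where
  open Graph G

  data Walk (s : Node) : Node → Set where
    []  : Walk s s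
    _▹_ : ∀ {v} → Walk s v → (p : Fin (deg v)) → Walk s (target v p)

module _ {G : Graph} where
  open Graph G

  steps : ∀ {s v} → Walk G s v → ℕ
  steps []      = 0
  steps (w ▹ p) = suc (steps w)

  visited : ∀ {s v} → Walk G s v → List Node
  visited {s} []                = s ∷ []
  visited     (_▹_ {v = v} w p) = target v p ∷ visited w

module _ (G : Graph) (s : Graph.Node G) where
  open Graph G

  Distance : Node → ℕ → Set
  Distance v k = (Σ (Walk G s v) λ w → steps w ≡ k) × (∀ (w : Walk G s v) → k ≤ steps w)

  Distance≤ Distance< : ℕ → Node → Set
  Distance≤ k v = ∃[ j ] Distance v j × j ≤ k
  Distance< k v = ∃[ j ] Distance v j × j < k

  Radius : ℕ → Set
  Radius r = (∀ v → Distance≤ r v) × (∃[ v ] Distance v r)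

  BallNode : ℕ → Node → Set
  BallNode k v = Distance≤ k v

  -- An undirected edge is represented by its dart at the smaller label.
  BallEdge : ℕ → Dart → Set
  BallEdge k (u , p) =
    label u < label (target u p) × (Distance< k u ⊎ Distance< k (target u p))

record Move : Set where
  constructor move
  field
    exit-port   : ℕ
    node-label  : ℕ
    node-degree : ℕ
    entry-port  : ℕ

record History : Set where
  constructor history
  field
    source-label  : ℕ
    source-degree : ℕ
    moves         : List Move     -- latest first

-- A value that is not a port number at the current node leaves the agent
-- stuck: no walk then follows the algorithm any further.
Algorithm : Set
Algorithm = History → ℕ

module _ {G : Graph} {s : Graph.Node G} where
  open Graph G

  moves : ∀ {v} → Walk G s v → List Move
  moves []                = []
  moves (_▹_ {v = v} w p) =
    move (toℕ p) (label (target v p)) (deg (target v p)) (toℕ (entry v p)) ∷ moves w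

  historyOf : ∀ {v} → Walk G s v → History
  historyOf w = history (label s) (deg s) (moves w)

  Follows : ∀ {v} → Algorithm → Walk G s v → Set
  Follows A []      = ⊤
  Follows A (w ▹ p) = Follows A w × A (historyOf w) ≡ toℕ p

  -- The last node of the walk is not visited before the end.
  FirstVisit : ∀ {v} → Walk G s v → Set
  FirstVisit []                = ⊤
  FirstVisit (_▹_ {v = v} w p) = target v p ∉ visited w

  Finds : Algorithm → (τ : Node) → Walk G s τ → Set
  Finds A τ w = Follows A w × FirstVisit w

  -- Number of traversals since the last replenishment.  On a return to s it
  -- still counts the whole excursion; the tank is refilled for the next move.
  fuelUsed : ∀ {v} → Walk G s v → ℕ
  fuelUsed []                = 0
  fuelUsed (_▹_ {v = v} w p) = suc (if does (v ≟ s) then 0 else fuelUsed w)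

  -- The unwound rope, as the stack of ports by which its edges were entered.
  -- The agent always stands at the end of the top edge, so leaving by the port
  -- on top undoes that edge.  Rewinding whenever possible keeps the rope as
  -- short as any other choice of forward and backward moves along the walk.
  rope : ∀ {v} → Walk G s v → List ℕ
  rope []                = []
  rope (_▹_ {v = v} w p) = traverse (rope w)
    where
    traverse : List ℕ → List ℕ
    traverse []       = toℕ (entry v p) ∷ []
    traverse (q ∷ qs) =
      if does (q ℕ.≟ toℕ p) then qs else toℕ (entry v p) ∷ q ∷ qs

  Always : (∀ {v} → Walk G s v → Set) → ∀ {v} → Walk G s v → Set
  Always P w@[]       = P w
  Always P w@(w′ ▹ p) = Always P w′ × P w

data Model : Set₁ where
  unrestricted    : Model
  fuel-restricted : (α : ℝ) → Positive α → Model
  rope-restricted : (α : ℝ) → Positive α → Model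

InModel : Model → Graph → Set
InModel unrestricted          G = ⊤
InModel (fuel-restricted _ _) G = Finite G
InModel (rope-restricted _ _) G = Finite G

Respects : Model → {G : Graph} {s v : Graph.Node G} → Walk G s v → Set
Respects unrestricted          w = ⊤
Respects (fuel-restricted α _) {G} {s} w =
  ∀ r → Radius G s r → Always (λ u → AtMost[ 2 ⟨1+ α ⟩ r ] (fuelUsed u)) w
Respects (rope-restricted α _) {G} {s} w =
  ∀ r → Radius G s r → Always (λ u → AtMost[ 1 ⟨1+ α ⟩ r ] (length (rope u))) w

IsTreasureHunt : Model → Algorithm → Set₁
IsTreasureHunt M A =
  ∀ (G : Graph) → InModel M G → ∀ (s τ : Graph.Node G) →
  Σ (Walk G s τ) λ w → Finds A τ w × Respects M w

Cost : Algorithm → (G : Graph) (s τ : Graph.Node G) → ℕ → Set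
Cost A G s τ k = Σ (Walk G s τ) λ w → Finds A τ w × steps w ≡ k

_≍[_]_ : ℕ → ℕ → ℕ → Set
a ≍[ c ] b = a ≤ c * b × b ≤ c * a

{-# OPTIONS --safe #-}

-- Let H be a path of length d attached at its first node s to a complete
-- tripartite graph in which s alone forms one part.  Hide the treasure either at
-- the far end of the path, or in a new node that subdivides one of the tripartite
-- edges.  Until it finds the treasure the agent cannot tell a subdivided graph
-- from H, so each of these hunts is a run of the algorithm in H, ending with a
-- traversal of the subdivided edge or, in the first case, having crossed the
-- whole path.  By determinism each run is a prefix of the longest one, which
-- therefore crosses all edges of H.  The graph of the longest hunt has at most one
-- edge more than H, and its radius is still d because every node of the subdivided
-- tripartite part is at distance at most 2 from s.

module Submission where

open import Data.Fin as Fin using (Fin; zero; suc; toℕ; fromℕ; fromℕ<; inject₁)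
open import Data.Fin.Induction using (<-weakInduction)
open import Data.Fin.Properties using
  (any?; toℕ<n; toℕ-fromℕ; toℕ-fromℕ<; toℕ-inject₁; toℕ-injective; toℕ-↑ˡ; toℕ-↑ʳ;
   inject₁-injective; injective⇒≤; +↔⊎; *↔×)
open import Data.List using (List; []; _∷_; length; map; lookup; allFin; filter)
open import Data.List.Extrema.Nat using (argmax; f[⊥]≤f[argmax]; f[xs]≤f[argmax])
open import Data.List.Membership.Propositional using (_∈_; _∉_)
open import Data.List.Membership.Propositional.Properties using
  (∈-map⁺; ∈-map⁻; ∈-allFin; ∈-lookup; ∈-filter⁺; ∈-filter⁻)
open import Data.List.Properties using (length-map; length-tabulate)
open import Data.List.Relation.Unary.All as All using (All)
open import Data.List.Relation.Unary.AllPairs using ([]; _∷_)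
open import Data.List.Relation.Unary.Any using (here; there; index)
open import Data.List.Relation.Unary.Any.Properties using (lookup-index)
open import Data.List.Relation.Unary.Unique.Propositional using (Unique)
import Data.List.Relation.Unary.Unique.Propositional.Properties as Unique
open import Data.Maybe using (Maybe; just; nothing; maybe′)
open import Data.Maybe.Properties using (just-injective)
open import Data.Nat using
  (ℕ; zero; suc; _+_; _*_; _^_; _∸_; _≤_; _<_; z≤n; s≤s; s≤s⁻¹; NonZero)
open import Data.Nat.DivMod using (_/_; _%_; m/n*n≤m; m%n≤n; m≡m%n+[m/n]*n)
open import Data.Nat.Induction using (<-rec)
open import Data.Nat.Properties hiding (_≟_)
open import Data.Product using (Σ; ∃; ∃-syntax; _×_; _,_; proj₁; proj₂)
import Data.Product.Properties as Product
open import Data.Sum using (_⊎_; inj₁; inj₂; [_,_]′; map₂; swap; reduce)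
open import Data.Sum.Function.Propositional using (_⊎-↔_)
open import Data.Sum.Properties using (inj₁-injective)
open import Data.Unit using (⊤; tt)
open import Function using (_∘_; id)
open import Function.Bundles using (_↔_; Inverse; mk⇔; mk↔ₛ′; Equivalence)
open import Function.Construct.Composition using (_↔-∘_)
open import Function.Construct.Identity using (↔-id)
open import Relation.Binary.Construct.Closure.ReflexiveTransitive as Star using
  (Star; ε; _◅_; _◅◅_)
open import Relation.Binary.PropositionalEquality
open import Relation.Nullary using (¬_; Dec; yes; no; contradiction)
open import Relation.Nullary.Decidable using (map′; _⊎-dec_)
open import Defs hiding (fromℕ)

-- Duplicate-free lists, enumerations and cardinalities

lookup-injective : ∀ {A : Set} {xs : List A} → Unique xs →
  ∀ {i j} → lookup xs i ≡ lookup xs j → i ≡ j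
lookup-injective (x∉ ∷ u) {zero}  {zero}  eq = refl
lookup-injective (x∉ ∷ u) {zero}  {suc j} eq = contradiction eq (All.lookup x∉ (∈-lookup j))
lookup-injective (x∉ ∷ u) {suc i} {zero}  eq = contradiction (sym eq) (All.lookup x∉ (∈-lookup i))
lookup-injective (x∉ ∷ u) {suc i} {suc j} eq = cong suc (lookup-injective u eq)

elements : ∀ {A : Set} {n} → Fin n ↔ A → List A
elements {n = n} F = map (Inverse.to F) (allFin n)

∈-elements : ∀ {A : Set} {n} (F : Fin n ↔ A) a → a ∈ elements F
∈-elements F a =
  subst (_∈ elements F) (Inverse.strictlyInverseˡ F a) (∈-map⁺ (Inverse.to F) (∈-allFin _))

Inverse-injective : ∀ {A B : Set} (F : A ↔ B) {x y} → Inverse.to F x ≡ Inverse.to F y → x ≡ y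
Inverse-injective F eq = trans (sym (Inverse.strictlyInverseʳ F _))
  (trans (cong (Inverse.from F) eq) (Inverse.strictlyInverseʳ F _))

elements-unique : ∀ {A : Set} {n} (F : Fin n ↔ A) → Unique (elements F)
elements-unique {n = n} F = Unique.map⁺ (Inverse-injective F) (Unique.allFin⁺ n)

universal-cardinality : ∀ {A : Set} {n} {P : A → Set} → Fin n ↔ A → (∀ a → P a) →
  HasCardinality P n
universal-cardinality {n = n} F all =
  elements F , elements-unique F , (λ a → mk⇔ (λ _ → all a) (λ _ → ∈-elements F a)) ,
  trans (length-map (Inverse.to F) (allFin n)) (length-tabulate id)

cardinality-cong : ∀ {A : Set} {P Q : A → Set} {n} → (∀ a → P a → Q a) → (∀ a → Q a → P a) →
  HasCardinality P n → HasCardinality Q n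
cardinality-cong f g (xs , u , mem , len) =
  xs , u , (λ a → mk⇔ (f a ∘ Equivalence.to (mem a)) (Equivalence.from (mem a) ∘ g a)) , len

module _ (G : Graph) where
  open Graph G

  ends : Dart → Node × Node
  ends e = proj₁ e , proj₁ (opp e)

  ends-injective : ∀ {e e′} → ends e ≡ ends e′ → e ≡ e′
  ends-injective {v , p} {v′ , p′} eq with cong proj₁ eq
  ... | refl = cong (v ,_) (no-multiple-edges v p p′ (cong proj₂ eq))

  -- This is the first half of `BallEdge`. Where every edge has an extremity at distance below `k`,
  -- the two predicates agree, so ball edges can be counted without computing distances.
  Oriented : Dart → Set
  Oriented (v , p) = label v < label (target v p)

  Adjacent-sym : ∀ {u v} → Adjacent u v → Adjacent v u
  Adjacent-sym {u} (p , refl) = entry u p , cong proj₁ (opp-involutive (u , p))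

-- Distances

module Distances (G : Graph) (s : Graph.Node G) where
  open Graph G

  Reach : ℕ → Node → Set
  Reach k v = Σ (Walk G s v) λ w → steps w ≡ k

  extend : ∀ {k u v} → Reach k u → Adjacent u v → Reach (suc k) v
  extend (w , eq) (p , refl) = w ▹ p , cong suc eq

  -- Degrees are finite, so it suffices to search the neighbours of `v` for one reached in one step
  -- less.
  reach? : ∀ k v → Dec (Reach k v)
  reach? zero v = map′ (λ { refl → [] , refl }) (λ { ([] , _) → refl }) (s ≟ v)
  reach? (suc k) v = map′ forth back (any? λ p → reach? k (target v p))
    where
    forth : ∃[ p ] Reach k (target v p) → Reach (suc k) v
    forth (p , r) = extend r (entry v p , cong proj₁ (opp-involutive (v , p)))
    back : ∀ {v} → Reach (suc k) v → ∃[ p ] Reach k (target v p)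
    back (w ▹ q , refl) with Adjacent-sym G (q , refl)
    ... | p , eq = p , subst (Reach k) (sym eq) (w , refl)

  -- `Distance` demands a shortest walk. Decidability of `Reach` yields one constructively, by
  -- passing to a shorter length as long as there is one.
  Reach⇒Distance≤ : ∀ k v → Reach k v → Distance≤ G s k v
  Reach⇒Distance≤ = <-rec _ λ k rec v r → shortest k rec v r (any? λ (i : Fin k) → reach? (toℕ i) v)
    where
    shortest : ∀ k → (∀ {j} → j < k → ∀ v → Reach j v → Distance≤ G s j v) →
      ∀ v → Reach k v → Dec (∃ λ (i : Fin k) → Reach (toℕ i) v) → Distance≤ G s k v
    shortest k rec v r (yes (i , r′)) with rec (toℕ<n i) v r′
    ... | j , dist , j≤i = j , dist , ≤-trans j≤i (<⇒≤ (toℕ<n i))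
    shortest k rec v r (no none) = k , (r , minimal) , ≤-refl
      where
      minimal : (w : Walk G s v) → k ≤ steps w
      minimal w = ≮⇒≥ λ lt → none (fromℕ< lt , w , sym (toℕ-fromℕ< lt))

  Distance≤-source : ∀ k → Distance≤ G s k s
  Distance≤-source k = 0 , (([] , refl) , λ _ → z≤n) , z≤n

  Distance≤-mono : ∀ {j k v} → j ≤ k → Distance≤ G s j v → Distance≤ G s k v
  Distance≤-mono j≤k (i , dist , i≤j) = i , dist , ≤-trans i≤j j≤k

  Distance≤-step : ∀ {k} u v → Distance≤ G s k u → Adjacent u v → Distance≤ G s (suc k) v
  Distance≤-step _ _ (j , (r , _) , j≤k) uv =
    Distance≤-mono (s≤s j≤k) (Reach⇒Distance≤ _ _ (extend r uv))

  Distance≤⇒< : ∀ {k v} → Distance≤ G s k v → Distance< G s (suc k) v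
  Distance≤⇒< (j , dist , j≤k) = j , dist , s≤s j≤k

  module _ (h : Node → ℕ) (h-source : h s ≡ 0)
           (h-step : ∀ v p → h (target v p) ≤ suc (h v)) where

    h≤steps : ∀ {v} (w : Walk G s v) → h v ≤ steps w
    h≤steps []      = ≤-reflexive h-source
    h≤steps (w ▹ p) = ≤-trans (h-step _ p) (s≤s (h≤steps w))

    -- By the Lipschitz bound on h the two exceptional nodes are not adjacent,
    -- so every edge has a near extremity.
    radius-and-near-edges : ∀ {d t b} → h t ≡ suc d → h b < d →
      (∀ v → v ≡ t ⊎ v ≡ b ⊎ Distance≤ G s d v) →
      Distance≤ G s (suc d) t → Distance≤ G s (suc d) b →
      Radius G s (suc d) ×
      (∀ v p → Distance< G s (suc d) v ⊎ Distance< G s (suc d) (target v p))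
    radius-and-near-edges {d} {t} {b} ht hb near within-t within-b =
      (within , t , at-t within-t) , near-edge
      where
      within : ∀ v → Distance≤ G s (suc d) v
      within v with near v
      ... | inj₁ refl        = within-t
      ... | inj₂ (inj₁ refl) = within-b
      ... | inj₂ (inj₂ n)    = Distance≤-mono (n≤1+n d) n

      far : (w : Walk G s t) → suc d ≤ steps w
      far w = subst (_≤ steps w) ht (h≤steps w)

      at-t : Distance≤ G s (suc d) t → Distance G s t (suc d)
      at-t (j , ((w , refl) , _) , j≤) = (w , ≤-antisym j≤ (far w)) , far

      apart : ¬ Adjacent b t
      apart (p , eq) = <-irrefl refl (begin-strict
        d           <⟨ n<1+n d ⟩
        suc d       ≡⟨ ht ⟨
        h t         ≡⟨ cong h eq ⟨
        h (target b p) ≤⟨ h-step b p ⟩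
        suc (h b)   ≤⟨ hb ⟩
        d           ∎)
        where open ≤-Reasoning

      near-edge : ∀ v p → Distance< G s (suc d) v ⊎ Distance< G s (suc d) (target v p)
      near-edge v p with near v | near (target v p)
      ... | inj₂ (inj₂ n) | _ = inj₁ (Distance≤⇒< n)
      ... | _ | inj₂ (inj₂ n) = inj₂ (Distance≤⇒< n)
      ... | inj₁ refl | inj₁ eq = contradiction eq (no-loops v p)
      ... | inj₁ refl | inj₂ (inj₁ eq) = contradiction (Adjacent-sym G (p , eq)) apart
      ... | inj₂ (inj₁ refl) | inj₁ eq = contradiction (p , eq) apart
      ... | inj₂ (inj₁ refl) | inj₂ (inj₁ eq) = contradiction eq (no-loops v p)

-- Walks and the edges they cross

module _ {G : Graph} {s : Graph.Node G} where
  open Graph G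

  darts : ∀ {v} → Walk G s v → List Dart
  darts []                = []
  darts (_▹_ {v = v} w p) = (v , p) ∷ darts w

  length-darts : ∀ {v} (w : Walk G s v) → length (darts w) ≡ steps w
  length-darts []      = refl
  length-darts (w ▹ p) = cong suc (length-darts w)

  Crosses : ∀ {v} → Walk G s v → Dart → Set
  Crosses w f = f ∈ darts w ⊎ opp f ∈ darts w

  Crosses-step : ∀ {v f} {w : Walk G s v} p → Crosses w f → Crosses (w ▹ p) f
  Crosses-step p (inj₁ i) = inj₁ (there i)
  Crosses-step p (inj₂ i) = inj₂ (there i)

  -- Each oriented dart is sent to a position of the walk where its edge is crossed. A position
  -- holds a single dart, and only one dart of an edge is oriented, so this map is injective.
  crossing-all⇒≤ : ∀ {e v} → HasCardinality (Oriented G) e → (w : Walk G s v) →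
    (∀ f → Oriented G f → Crosses w f) → e ≤ steps w
  crossing-all⇒≤ (fs , unique , mem , refl) w all =
    subst (length fs ≤_) (length-darts w) (injective⇒≤ {f = position} injective)
    where
    oriented : ∀ i → Oriented G (lookup fs i)
    oriented i = Equivalence.to (mem _) (∈-lookup i)
    crossing : ∀ i → Crosses w (lookup fs i)
    crossing i = all _ (oriented i)
    at : ∀ {f} → Crosses w f → Fin (length (darts w))
    at = [ index , index ]′
    position : Fin (length fs) → Fin (length (darts w))
    position i = at (crossing i)
    not-both : ∀ {f g} → Oriented G f → Oriented G g → f ≢ opp g
    not-both {g = g} of og refl =
      <-asym og (subst (label (proj₁ (opp g)) <_) (cong (label ∘ proj₁) (opp-involutive g)) of)
    at-index : ∀ {f} (i : f ∈ darts w) → f ≡ lookup (darts w) (index i)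
    at-index i = lookup-index i
    same : ∀ {f g} → Oriented G f → Oriented G g → (cf : Crosses w f) (cg : Crosses w g) →
      at cf ≡ at cg → f ≡ g
    same of og (inj₁ i) (inj₁ j) eq =
      trans (at-index i) (trans (cong (lookup (darts w)) eq) (sym (at-index j)))
    same of og (inj₁ i) (inj₂ j) eq = contradiction
      (trans (at-index i) (trans (cong (lookup (darts w)) eq) (sym (at-index j))))
      (not-both of og)
    same of og (inj₂ i) (inj₁ j) eq = contradiction
      (trans (at-index j) (trans (cong (lookup (darts w)) (sym eq)) (sym (at-index i))))
      (not-both og of)
    same {f} {g} of og (inj₂ i) (inj₂ j) eq = trans (sym (opp-involutive f)) (trans
      (cong opp (trans (at-index i) (trans (cong (lookup (darts w)) eq) (sym (at-index j)))))
      (opp-involutive g))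
    injective : ∀ {i j} → position i ≡ position j → i ≡ j
    injective {i} {j} eq =
      lookup-injective unique (same (oriented i) (oriented j) (crossing i) (crossing j) eq)

  module _ {A : Algorithm} where

    -- The next port is a function of the history, so induction on the length applies. The equation
    -- is between pairs because equality of the end nodes is itself part of the conclusion.
    Follows-deterministic : ∀ {u v} (w : Walk G s u) (w′ : Walk G s v) →
      Follows A w → Follows A w′ → steps w ≡ steps w′ →
      _≡_ {A = Σ Node (Walk G s)} (u , w) (v , w′)
    Follows-deterministic []      []        _ _ _ = refl
    Follows-deterministic (w ▹ p) (w′ ▹ p′) (fw , fp) (fw′ , fp′) eq
      with Follows-deterministic w w′ fw fw′ (suc-injective eq)
    ... | refl with toℕ-injective (trans (sym fp) fp′)
    ... | refl = refl

    -- The longer walk is cut back until the lengths agree; determinism then identifies the two, and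
    -- crossings persist under extension.
    Follows-prefix : ∀ {u v} (w : Walk G s u) (w′ : Walk G s v) →
      Follows A w → Follows A w′ → steps w ≤ steps w′ → ∀ {f} → Crosses w f → Crosses w′ f
    Follows-prefix w w′ fw fw′ le c with m≤n⇒m<n∨m≡n le
    Follows-prefix w w′ fw fw′ le c | inj₂ eq with Follows-deterministic w w′ fw fw′ eq
    ... | refl = c
    Follows-prefix w (w′ ▹ p) fw (fw′ , _) le c | inj₁ (s≤s lt) =
      Crosses-step p (Follows-prefix w w′ fw fw′ lt c)

-- Subdividing an edge

module Subdivision (G : Graph) (N : ℕ) (bound : ∀ v → Graph.label G v < N)
                   (f : Graph.Dart G) where
  open Graph G

  Node′ : Set
  Node′ = Maybe Node

  -- Old nodes keep their degrees and ports; only the far ends of the two darts of the subdivided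
  -- edge change. This is what hides the subdivision from the agent.
  deg′ : Node′ → ℕ
  deg′ nothing  = 2
  deg′ (just v) = deg v

  Dart′ : Set
  Dart′ = Σ Node′ λ v → Fin (deg′ v)

  embed : Dart → Dart′
  embed (v , p) = just v , p

  embed-injective : ∀ {e e′} → embed e ≡ embed e′ → e ≡ e′
  embed-injective refl = refl

  opaque
    _≟ᴰ_ : (e e′ : Dart) → Dec (e ≡ e′)
    _≟ᴰ_ = Product.≡-dec _≟_ Fin._≟_

  reroute : ∀ e → Dec (e ≡ f) → Dec (e ≡ opp f) → Dart′
  reroute e (yes _) _       = nothing , zero
  reroute e (no _)  (yes _) = nothing , suc zero
  reroute e (no _)  (no _)  = embed (opp e)

  opp′ : Dart′ → Dart′
  opp′ (nothing , zero)     = embed f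
  opp′ (nothing , suc zero) = embed (opp f)
  opp′ (just v , p)         = reroute (v , p) ((v , p) ≟ᴰ f) ((v , p) ≟ᴰ opp f)

  -- A view of `opp′` on old darts: abstracting `opp′ (embed e)` together with it turns the two
  -- nested decisions into one three-way case split.
  data Rerouted (e : Dart) : Dart′ → Set where
    first  : e ≡ f → Rerouted e (nothing , zero)
    second : e ≡ opp f → Rerouted e (nothing , suc zero)
    same   : e ≢ f → e ≢ opp f → Rerouted e (embed (opp e))

  rerouted : ∀ e → Rerouted e (opp′ (embed e))
  rerouted e@(v , p) with e ≟ᴰ f | e ≟ᴰ opp f
  ... | yes eq | _      = first eq
  ... | no _   | yes eq = second eq
  ... | no ≢f  | no ≢f′ = same ≢f ≢f′

  f≢opp-f : f ≢ opp f
  f≢opp-f eq = no-loops (proj₁ f) (proj₂ f) (cong proj₁ (sym eq))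

  opp-swap : ∀ {e e′} → opp e ≡ e′ → e ≡ opp e′
  opp-swap {e} eq = trans (sym (opp-involutive e)) (cong opp eq)

  opp′-first : opp′ (embed f) ≡ (nothing , zero)
  opp′-first with opp′ (embed f) | rerouted f
  ... | _ | first _  = refl
  ... | _ | second eq = contradiction eq f≢opp-f
  ... | _ | same ne _ = contradiction refl ne

  opp′-second : opp′ (embed (opp f)) ≡ (nothing , suc zero)
  opp′-second with opp′ (embed (opp f)) | rerouted (opp f)
  ... | _ | first eq  = contradiction (sym eq) f≢opp-f
  ... | _ | second _  = refl
  ... | _ | same _ ne = contradiction refl ne

  opp′-same : ∀ {e} → e ≢ f → e ≢ opp f → opp′ (embed e) ≡ embed (opp e)
  opp′-same {e} ≢f ≢f′ with opp′ (embed e) | rerouted e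
  ... | _ | first eq  = contradiction eq ≢f
  ... | _ | second eq = contradiction eq ≢f′
  ... | _ | same _ _  = refl

  opp′-involutive : ∀ e → opp′ (opp′ e) ≡ e
  opp′-involutive (nothing , zero)     = opp′-first
  opp′-involutive (nothing , suc zero) = opp′-second
  opp′-involutive (just v , p) with opp′ (just v , p) | rerouted (v , p)
  ... | _ | first refl  = refl
  ... | _ | second refl = refl
  ... | _ | same ≢f ≢f′ =
    trans (opp′-same (≢f′ ∘ opp-swap)
                     (λ eq → ≢f (trans (opp-swap eq) (opp-involutive f))))
          (cong embed (opp-involutive (v , p)))

  label′ : Node′ → ℕ
  label′ nothing  = N
  label′ (just v) = label v

  label′-positive : ∀ v → 0 < label′ v
  label′-positive nothing  = ≤-<-trans z≤n (bound (proj₁ f))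
  label′-positive (just v) = label-positive v

  label′-injective : ∀ {u v} → label′ u ≡ label′ v → u ≡ v
  label′-injective {nothing} {nothing} eq = refl
  label′-injective {nothing} {just v}  eq = contradiction (sym eq) (<⇒≢ (bound v))
  label′-injective {just u}  {nothing} eq = contradiction eq (<⇒≢ (bound u))
  label′-injective {just u}  {just v}  eq = cong just (label-injective eq)

  no-loops′ : ∀ v p → proj₁ (opp′ (v , p)) ≢ v
  no-loops′ nothing  zero       ()
  no-loops′ nothing  (suc zero) ()
  no-loops′ (just v) p eq with opp′ (just v , p) | rerouted (v , p)
  no-loops′ (just v) p () | _ | first _
  no-loops′ (just v) p () | _ | second _
  no-loops′ (just v) p eq | _ | same _ _ = no-loops v p (just-injective eq)

  no-multiple-edges′ : ∀ v p q → proj₁ (opp′ (v , p)) ≡ proj₁ (opp′ (v , q)) → p ≡ q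
  no-multiple-edges′ nothing zero       zero       eq = refl
  no-multiple-edges′ nothing zero       (suc zero) eq =
    contradiction (sym (just-injective eq)) (no-loops (proj₁ f) (proj₂ f))
  no-multiple-edges′ nothing (suc zero) zero       eq =
    contradiction (just-injective eq) (no-loops (proj₁ f) (proj₂ f))
  no-multiple-edges′ nothing (suc zero) (suc zero) eq = refl
  no-multiple-edges′ (just v) p q eq
    with opp′ (just v , p) | rerouted (v , p) | opp′ (just v , q) | rerouted (v , q)
  no-multiple-edges′ (just v) p q eq | _ | first refl  | _ | first refl  = refl
  no-multiple-edges′ (just v) p q eq | _ | first refl  | _ | second e =
    contradiction (sym (cong proj₁ e)) (no-loops v p)
  no-multiple-edges′ (just v) p q () | _ | first _     | _ | same _ _
  no-multiple-edges′ (just v) p q eq | _ | second e    | _ | first refl =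
    contradiction (sym (cong proj₁ e)) (no-loops v q)
  no-multiple-edges′ (just v) p q eq | _ | second refl | _ | second refl = refl
  no-multiple-edges′ (just v) p q () | _ | second _    | _ | same _ _
  no-multiple-edges′ (just v) p q () | _ | same _ _    | _ | first _
  no-multiple-edges′ (just v) p q () | _ | same _ _    | _ | second _
  no-multiple-edges′ (just v) p q eq | _ | same _ _    | _ | same _ _ =
    no-multiple-edges v p q (just-injective eq)

  Adjacent′ : Node′ → Node′ → Set
  Adjacent′ u v = ∃[ p ] proj₁ (opp′ (u , p)) ≡ v

  first-half : Adjacent′ (just (proj₁ f)) nothing
  first-half = proj₂ f , cong proj₁ opp′-first

  second-half : Adjacent′ (just (proj₁ (opp f))) nothing
  second-half = proj₂ (opp f) , cong proj₁ opp′-second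

  detour : ∀ u p → Star Adjacent′ (just u) (just (target u p))
  detour u p with (u , p) ≟ᴰ f | (u , p) ≟ᴰ opp f
  ... | yes refl | _        = first-half ◅ (suc zero , refl) ◅ ε
  ... | no _     | yes refl =
    second-half ◅ (zero , cong (just ∘ proj₁) (sym (opp-involutive f))) ◅ ε
  ... | no ≢f    | no ≢f′   = (p , cong proj₁ (opp′-same ≢f ≢f′)) ◅ ε

  connected-just : ∀ {u v} → Star Adjacent u v → Star Adjacent′ (just u) (just v)
  connected-just ε                   = ε
  connected-just ((p , refl) ◅ path) = detour _ p ◅◅ connected-just path

  connected′ : ∀ u v → Star Adjacent′ u v
  connected′ (just u) (just v) = connected-just (connected u v)
  connected′ (just u) nothing  = connected-just (connected u (proj₁ f)) ◅◅ first-half ◅ ε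
  connected′ nothing  (just v) = (zero , refl) ◅ connected-just (connected (proj₁ f) v)
  connected′ nothing  nothing  = ε

  subdivided : Graph
  subdivided = record
    { Node              = Node′
    ; label             = label′
    ; label-positive    = label′-positive
    ; label-injective   = label′-injective
    ; deg               = deg′
    ; opp               = opp′
    ; opp-involutive    = opp′-involutive
    ; no-loops          = no-loops′
    ; no-multiple-edges = no-multiple-edges′
    ; connected         = connected′
    }

  -- The subdivided edge is excluded through its pair of ends rather than its darts, so that it can
  -- be ruled out by comparing nodes.
  Adjacent-lift : ∀ u v → Adjacent u v →
    (u , v) ≢ ends G f → (v , u) ≢ ends G f → Adjacent′ (just u) (just v)
  Adjacent-lift u _ (p , refl) ≢f ≢f′ = p , cong proj₁
    (opp′-same (λ { refl → ≢f refl })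
               (λ eq → ≢f′ (cong₂ _,_ (cong proj₁ (sym (opp-swap (sym eq)))) (cong proj₁ eq))))

  module _ (h : Node → ℕ) (h-step : ∀ v p → h (target v p) ≤ suc (h v))
           (h-first : h (proj₁ f) ≡ 0) (h-second : h (proj₁ (opp f)) ≡ 0) where

    height′ : Node′ → ℕ
    height′ = maybe′ h 0

    -- The new node has height 0, like both ends of `f`, so the two halves of `f` are level.
    height′-step : ∀ v p → height′ (proj₁ (opp′ (v , p))) ≤ suc (height′ v)
    height′-step nothing zero       = subst (_≤ 1) (sym h-first) z≤n
    height′-step nothing (suc zero) = subst (_≤ 1) (sym h-second) z≤n
    height′-step (just v) p with opp′ (just v , p) | rerouted (v , p)
    ... | _ | first _  = z≤n
    ... | _ | second _ = z≤n
    ... | _ | same _ _ = h-step v p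

  -- The new label exceeds all others, so both halves of `f` are oriented from their old ends: to
  -- the old oriented darts, `f` among them, exactly `opp f` is added.
  oriented-cardinality : ∀ {n} → Oriented G f →
    HasCardinality (Oriented G) n → HasCardinality (Oriented subdivided) (suc n)
  oriented-cardinality of (es , unique , mem , len) =
    embed (opp f) ∷ map embed es ,
    All.tabulate fresh ∷ Unique.map⁺ embed-injective unique ,
    (λ e → mk⇔ (sound e) (complete e)) ,
    cong suc (trans (length-map embed es) len)
    where
    opp-f-not-oriented : ¬ Oriented G (opp f)
    opp-f-not-oriented o =
      <-asym of (subst (label (proj₁ (opp f)) <_) (cong (label ∘ proj₁) (opp-involutive f)) o)

    fresh : ∀ {e} → e ∈ map embed es → embed (opp f) ≢ e
    fresh i refl with ∈-map⁻ embed i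
    ... | e , e∈ , eq = opp-f-not-oriented
      (subst (Oriented G) (sym (embed-injective eq)) (Equivalence.to (mem e) e∈))

    embed-oriented : ∀ e → e ≡ opp f ⊎ Oriented G e → Oriented subdivided (embed e)
    embed-oriented (v , p) o with opp′ (just v , p) | rerouted (v , p)
    ... | _ | first _  = bound v
    ... | _ | second _ = bound v
    embed-oriented (v , p) (inj₁ eq) | _ | same _ ≢f′ = contradiction eq ≢f′
    embed-oriented (v , p) (inj₂ o)  | _ | same _ _   = o

    sound : ∀ e → e ∈ embed (opp f) ∷ map embed es → Oriented subdivided e
    sound _ (here refl) = embed-oriented (opp f) (inj₁ refl)
    sound _ (there i) with ∈-map⁻ embed i
    ... | e , e∈ , refl = embed-oriented e (inj₂ (Equivalence.to (mem e) e∈))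

    complete : ∀ e → Oriented subdivided e → e ∈ embed (opp f) ∷ map embed es
    complete (nothing , zero)     o = contradiction (bound _) (<-asym o)
    complete (nothing , suc zero) o = contradiction (bound _) (<-asym o)
    complete (just v , p) o with opp′ (just v , p) | rerouted (v , p)
    ... | _ | first refl  = there (∈-map⁺ embed (Equivalence.from (mem f) of))
    ... | _ | second refl = here refl
    ... | _ | same _ _    = there (∈-map⁺ embed (Equivalence.from (mem (v , p)) o))

  module _ {s : Node} {A : Algorithm} where

    history-cong : ∀ {ms ms′ k} → ms ≡ ms′ →
      A (history (label s) (deg s) ms′) ≡ k → A (history (label s) (deg s) ms) ≡ k
    history-cong refl eq = eq

    -- While the new node is avoided, every traversal falls under `same` and shows the same label,
    -- degree and entry port in both graphs. Equality of `moves` is carried along because it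
    -- transfers the choices of `A`.
    project : ∀ {v′} (w′ : Walk subdivided (just s) v′) → nothing ∉ visited w′ →
      ∃[ v ] v′ ≡ just v × Σ (Walk G s v) λ w →
        steps w ≡ steps w′ × moves w ≡ moves w′ × (Follows A w′ → Follows A w)
    project [] _ = s , refl , [] , refl , refl , id
    project (w′ ▹ p) nothing∉ with project w′ (nothing∉ ∘ there)
    ... | v , refl , w , steps-≡ , moves-≡ , follows with opp′ (just v , p) in eq | rerouted (v , p)
    ... | _ | first _  = contradiction (here refl) nothing∉
    ... | _ | second _ = contradiction (here refl) nothing∉
    ... | _ | same _ _ =
      target v p , refl , w ▹ p , cong suc steps-≡ , cong (_ ∷_) moves-≡ ,
      λ (fw′ , fp) → follows fw′ , history-cong moves-≡ fp

    -- Up to the moment when A enters the new node it cannot tell the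
    -- subdivided graph from G, where its next traversal crosses f.
    project-hunt : ∀ {v′} (w′ : Walk subdivided (just s) v′) → v′ ≡ nothing →
      Follows A w′ → FirstVisit w′ →
      ∃[ v ] Σ (Walk G s v) λ w → steps w ≡ steps w′ × Follows A w × Crosses w f
    -- `FirstVisit` keeps the new node out of `w′`, so all but the last traversal projects; the last
    -- one leaves by the port of `f` or of `opp f`.
    project-hunt (w′ ▹ p) eq (fw′ , fp) first-visit
      with project w′ (subst (_∉ visited w′) eq first-visit)
    ... | v , refl , w , steps-≡ , moves-≡ , follows with opp′ (just v , p) | rerouted (v , p)
    ... | _ | first refl =
      _ , w ▹ p , cong suc steps-≡ , (follows fw′ , history-cong moves-≡ fp) , inj₁ (here refl)
    ... | _ | second refl =
      _ , w ▹ p , cong suc steps-≡ , (follows fw′ , history-cong moves-≡ fp) , inj₂ (here refl)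
    project-hunt (w′ ▹ p) () (fw′ , fp) first-visit
      | v , refl , w , steps-≡ , moves-≡ , follows | _ | same _ _

-- Graphs given by a list of increasing edges

Link : ∀ {V E : Set} → (E → V × V) → V → V → Set
Link edge u v = ∃[ i ] (edge i ≡ (u , v) ⊎ edge i ≡ (v , u))

rankIn : ∀ {V : Set} {n} → Fin n ↔ V → V → ℕ
rankIn F v = toℕ (Inverse.from F v)

-- `increasing` excludes loops and reversed duplicates, and makes the listed direction of an edge
-- the oriented one, as labels follow `rank`.
module EdgeListGraph
  {V E : Set} {n e : ℕ} (V↔ : Fin n ↔ V) (E↔ : Fin e ↔ E)
  (edge : E → V × V) (edge-injective : ∀ {i j} → edge i ≡ edge j → i ≡ j)
  (increasing : ∀ i → rankIn V↔ (proj₁ (edge i)) < rankIn V↔ (proj₂ (edge i)))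
  (linked : ∀ u v → Star (Link edge) u v) where

  rank : V → ℕ
  rank = rankIn V↔

  rank-injective : ∀ {u v} → rank u ≡ rank v → u ≡ v
  rank-injective eq = trans (sym (Inverse.strictlyInverseˡ V↔ _))
    (trans (cong (Inverse.to V↔) (toℕ-injective eq)) (Inverse.strictlyInverseˡ V↔ _))

  _≟ⱽ_ : (u v : V) → Dec (u ≡ v)
  u ≟ⱽ v = map′ rank-injective (cong rank) (rank u Data.Nat.≟ rank v)

  link? : ∀ u v → Dec (Link edge u v)
  link? u v = map′ (λ (k , l) → Inverse.to E↔ k , l)
    (λ (i , l) → Inverse.from E↔ i ,
      subst (λ j → edge j ≡ (u , v) ⊎ edge j ≡ (v , u)) (sym (Inverse.strictlyInverseˡ E↔ i)) l)
    (any? λ k → let uv = edge (Inverse.to E↔ k) in (uv ≟ⱽ² (u , v)) ⊎-dec (uv ≟ⱽ² (v , u)))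
    where
    _≟ⱽ²_ : (x y : V × V) → Dec (x ≡ y)
    _≟ⱽ²_ = Product.≡-dec _≟ⱽ_ _≟ⱽ_

  Link-sym : ∀ {u v} → Link edge u v → Link edge v u
  Link-sym (i , l) = i , swap l

  edge-increasing : ∀ {i u v} → edge i ≡ (u , v) → rank u < rank v
  edge-increasing {i} eq = subst (λ (u , v) → rank u < rank v) eq (increasing i)

  Link-irrefl : ∀ {v} → ¬ Link edge v v
  Link-irrefl (i , l) = <-irrefl refl (edge-increasing (reduce l))

  opaque
    neighbours : V → List V
    neighbours v = filter (link? v) (elements V↔)

    neighbours-unique : ∀ v → Unique (neighbours v)
    neighbours-unique v = Unique.filter⁺ (link? v) (elements-unique V↔)

    ∈-neighbours⁺ : ∀ {u v} → Link edge u v → v ∈ neighbours u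
    ∈-neighbours⁺ {u} {v} l = ∈-filter⁺ (link? u) (∈-elements V↔ v) l

    ∈-neighbours⁻ : ∀ {u v} → v ∈ neighbours u → Link edge u v
    ∈-neighbours⁻ {u} i = proj₂ (∈-filter⁻ (link? u) {xs = elements V↔} i)

  degree : V → ℕ
  degree v = length (neighbours v)

  nbr : ∀ v → Fin (degree v) → V
  nbr v = lookup (neighbours v)

  nbr-linked : ∀ v p → Link edge v (nbr v p)
  nbr-linked v p = ∈-neighbours⁻ (∈-lookup p)

  port : ∀ {u v} → Link edge u v → Fin (degree u)
  port l = index (∈-neighbours⁺ l)

  nbr-port : ∀ {u v} (l : Link edge u v) → nbr u (port l) ≡ v
  nbr-port l = sym (lookup-index (∈-neighbours⁺ l))

  opposite : Σ V (Fin ∘ degree) → Σ V (Fin ∘ degree)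
  opposite (v , p) = nbr v p , port (Link-sym (nbr-linked v p))

  -- Ports are positions in duplicate-free neighbour lists, so the extremities determine a dart;
  -- this makes `opposite` an involution.
  dart-≡ : ∀ {u v p q} → u ≡ v → nbr u p ≡ nbr v q → (u , p) ≡ (v , q)
  dart-≡ {u} refl eq = cong (u ,_) (lookup-injective (neighbours-unique u) eq)

  graph : Graph
  graph = record
    { Node              = V
    ; label             = suc ∘ rank
    ; label-positive    = λ _ → s≤s z≤n
    ; label-injective   = rank-injective ∘ suc-injective
    ; deg               = degree
    ; opp               = opposite
    ; opp-involutive    = λ (v , p) → dart-≡ (nbr-port (Link-sym (nbr-linked v p))) (nbr-port _)
    ; no-loops          = λ v p eq → Link-irrefl (subst (Link edge v) eq (nbr-linked v p))
    ; no-multiple-edges = λ v p q eq → lookup-injective (neighbours-unique v) eq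
    ; connected         = λ u v → Star.map (λ l → port l , nbr-port l) (linked u v)
    }

  label-bound : ∀ v → Graph.label graph v < suc n
  label-bound v = s≤s (toℕ<n (Inverse.from V↔ v))

  dart : E → Graph.Dart graph
  dart i = proj₁ (edge i) , port (i , inj₁ refl)

  ends-dart : ∀ i → ends graph (dart i) ≡ edge i
  ends-dart i = cong (proj₁ (edge i) ,_) (nbr-port (i , inj₁ refl))

  dart-oriented : ∀ i → Oriented graph (dart i)
  dart-oriented i = s≤s (edge-increasing {i} (sym (ends-dart i)))

  oriented⇒dart : ∀ f → Oriented graph f → ∃[ i ] f ≡ dart i
  oriented⇒dart (v , p) (s≤s o) with nbr-linked v p
  ... | i , inj₁ eq = i , ends-injective graph (trans (sym eq) (sym (ends-dart i)))
  ... | i , inj₂ eq = contradiction (edge-increasing eq) (<-asym o)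

  oriented-cardinality : HasCardinality (Oriented graph) e
  oriented-cardinality =
    map dart (elements E↔) ,
    Unique.map⁺ dart-injective (elements-unique E↔) ,
    (λ f → mk⇔ sound (complete f)) ,
    trans (length-map dart (elements E↔))
      (trans (length-map (Inverse.to E↔) (allFin e)) (length-tabulate id))
    where
    dart-injective : ∀ {i j} → dart i ≡ dart j → i ≡ j
    dart-injective {i} {j} eq =
      edge-injective (trans (sym (ends-dart i)) (trans (cong (ends graph) eq) (ends-dart j)))
    sound : ∀ {f} → f ∈ map dart (elements E↔) → Oriented graph f
    sound f∈ with ∈-map⁻ dart f∈
    ... | i , _ , refl = dart-oriented i
    complete : ∀ f → Oriented graph f → f ∈ map dart (elements E↔)
    complete f o with oriented⇒dart f o
    ... | i , refl = ∈-map⁺ dart (∈-elements E↔ i)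

-- The hard instance

Maybe↔ : ∀ {A : Set} {n} → Fin n ↔ A → Fin (suc n) ↔ Maybe A
Maybe↔ {A} {n} F = mk↔ₛ′ to from
  (λ { nothing → refl ; (just a) → cong just (Inverse.strictlyInverseˡ F a) })
  (λ { zero → refl ; (suc i) → cong suc (Inverse.strictlyInverseʳ F i) })
  where
  to : Fin (suc n) → Maybe A
  to zero    = nothing
  to (suc i) = just (Inverse.to F i)
  from : Maybe A → Fin (suc n)
  from nothing  = zero
  from (just a) = suc (Inverse.from F a)

finite⇒InModel : ∀ M {G} → Finite G → InModel M G
finite⇒InModel unrestricted          _   = tt
finite⇒InModel (fuel-restricted _ _) fin = fin
finite⇒InModel (rope-restricted _ _) fin = fin

-- A path of length d whose first node, the hub, is the one-node part of a
-- complete tripartite graph with parts of sizes 1, a and b.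
module Broom (d₂ a b : ℕ) where
  -- `d` is at least 2 because subdivision can put a node at distance 2 from the hub, which must not
  -- exceed the radius.
  d₁ d : ℕ
  d₁ = suc d₂
  d  = suc d₁

  Bristle V : Set
  Bristle = Fin a ⊎ Fin b
  V       = Fin (suc d) ⊎ Bristle

  pattern spine k = inj₁ k
  pattern bristle y = inj₂ y

  -- Only dense edges get subdivided: subdividing a spine edge would push the tip to distance
  -- `d + 1`.
  DenseEdge E : Set
  DenseEdge = Bristle ⊎ (Fin a × Fin b)
  E         = Fin d ⊎ DenseEdge

  pattern spineEdge k = inj₁ k
  pattern denseEdge j = inj₂ j

  hub tip : V
  hub = spine zero
  tip = spine (fromℕ d)

  edge : E → V × V
  edge (spineEdge k)               = spine (inject₁ k) , spine (suc k)
  edge (denseEdge (inj₁ y))        = hub , bristle y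
  edge (denseEdge (inj₂ (i , j)))  = bristle (inj₁ i) , bristle (inj₂ j)

  nodeCount denseCount edgeCount : ℕ
  nodeCount  = suc d + (a + b)
  denseCount = (a + b) + a * b
  edgeCount  = d + denseCount

  DenseEdge↔ : Fin denseCount ↔ DenseEdge
  DenseEdge↔ = (+↔⊎ ⊎-↔ *↔×) ↔-∘ +↔⊎

  opaque
    V↔ : Fin nodeCount ↔ V
    V↔ = (↔-id _ ⊎-↔ +↔⊎) ↔-∘ +↔⊎

    E↔ : Fin edgeCount ↔ E
    E↔ = (↔-id _ ⊎-↔ DenseEdge↔) ↔-∘ +↔⊎

  edge-injective : ∀ {i j} → edge i ≡ edge j → i ≡ j
  edge-injective {spineEdge k} {spineEdge l} eq =
    cong spineEdge (inject₁-injective (inj₁-injective (cong proj₁ eq)))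
  edge-injective {denseEdge (inj₁ _)} {denseEdge (inj₁ _)} refl = refl
  edge-injective {denseEdge (inj₂ _)} {denseEdge (inj₂ _)} refl = refl
  edge-injective {spineEdge k} {denseEdge (inj₁ _)} eq with () ← cong proj₂ eq
  edge-injective {spineEdge k} {denseEdge (inj₂ _)} eq with () ← cong proj₂ eq
  edge-injective {denseEdge (inj₁ _)} {spineEdge k} eq with () ← cong proj₂ eq
  edge-injective {denseEdge (inj₂ _)} {spineEdge k} eq with () ← cong proj₂ eq

  rank : V → ℕ
  rank = rankIn V↔

  opaque
    unfolding V↔

    rank-spine : ∀ k → rank (spine k) ≡ toℕ k
    rank-spine k = toℕ-↑ˡ k (a + b)

    -- The enumeration lists the spine from the hub outwards, then the bristles of the first kind,
    -- then those of the second.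
    increasing : ∀ i → rank (proj₁ (edge i)) < rank (proj₂ (edge i))
    increasing (spineEdge k) = begin-strict
      rank (spine (inject₁ k)) ≡⟨ trans (rank-spine (inject₁ k)) (toℕ-inject₁ k) ⟩
      toℕ k                    <⟨ n<1+n (toℕ k) ⟩
      suc (toℕ k)              ≡⟨ rank-spine (suc k) ⟨
      rank (spine (suc k))     ∎
      where open ≤-Reasoning
    increasing (denseEdge (inj₁ y)) = s≤s z≤n
    increasing (denseEdge (inj₂ (i , j))) = begin-strict
      rank (bristle (inj₁ i)) ≡⟨ toℕ-↑ʳ (suc d) (i Fin.↑ˡ b) ⟩
      suc d + toℕ (i Fin.↑ˡ b) ≡⟨ cong (suc d +_) (toℕ-↑ˡ i b) ⟩
      suc d + toℕ i           <⟨ +-monoʳ-< (suc d) (≤-trans (toℕ<n i) (m≤m+n a (toℕ j))) ⟩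
      suc d + (a + toℕ j)     ≡⟨ cong (suc d +_) (toℕ-↑ʳ a j) ⟨
      suc d + toℕ (a Fin.↑ʳ j) ≡⟨ toℕ-↑ʳ (suc d) (a Fin.↑ʳ j) ⟨
      rank (bristle (inj₂ j)) ∎
      where open ≤-Reasoning

  linked-from-hub : ∀ v → Star (Link edge) hub v
  linked-from-hub (spine k) = <-weakInduction (λ k → Star (Link edge) hub (spine k)) ε
    (λ k path → path ◅◅ (spineEdge k , inj₁ refl) ◅ ε) k
  linked-from-hub (bristle y) = (denseEdge (inj₁ y) , inj₁ refl) ◅ ε

  linked : ∀ u v → Star (Link edge) u v
  linked u v = Star.reverse (λ (i , l) → i , swap l) (linked-from-hub u) ◅◅ linked-from-hub v

  open EdgeListGraph V↔ E↔ edge edge-injective increasing linked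
    using (graph; nbr-linked; dart; ends-dart; dart-oriented; oriented⇒dart; label-bound; _≟ⱽ_;
           oriented-cardinality)
  open Graph graph using (target; Adjacent)

  -- A lower bound for the distance from the hub, exact on the spine. It vanishes at both ends of
  -- every dense edge, as `height′` requires.
  height : V → ℕ
  height (spine k)   = toℕ k
  height (bristle _) = 0

  height-step : ∀ v p → height (target v p) ≤ suc (height v)
  height-step v p = link-step (nbr-linked v p)
    where
    link-step : ∀ {u v} → Link edge u v → height v ≤ suc (height u)
    link-step (spineEdge k , inj₁ refl) = ≤-reflexive (cong suc (sym (toℕ-inject₁ k)))
    link-step (spineEdge k , inj₂ refl) =
      ≤-trans (≤-reflexive (toℕ-inject₁ k)) (m≤n+m (toℕ k) 2)
    link-step (denseEdge (inj₁ _) , inj₁ refl) = z≤n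
    link-step (denseEdge (inj₁ _) , inj₂ refl) = z≤n
    link-step (denseEdge (inj₂ _) , inj₁ refl) = z≤n
    link-step (denseEdge (inj₂ _) , inj₂ refl) = z≤n

  -- Dense edges stay at height 0 and each spine edge joins two consecutive heights.
  height-crossing : ∀ {k u v} → Link edge u v → height u ≤ toℕ k → toℕ k < height v →
    edge (spineEdge k) ≡ (u , v)
  height-crossing {k} (spineEdge i , inj₁ refl) hu hv
    with toℕ-injective (≤-antisym (subst (_≤ toℕ k) (toℕ-inject₁ i) hu) (s≤s⁻¹ hv))
  ... | refl = refl
  height-crossing {k} (spineEdge i , inj₂ refl) hu hv =
    contradiction (<-trans hu (subst (toℕ k <_) (toℕ-inject₁ i) hv)) (<-irrefl refl)

  height-crossing (denseEdge (inj₁ _) , inj₁ refl) _ ()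
  height-crossing (denseEdge (inj₁ _) , inj₂ refl) _ ()
  height-crossing (denseEdge (inj₂ _) , inj₁ refl) _ ()
  height-crossing (denseEdge (inj₂ _) , inj₂ refl) _ ()

  -- A discrete intermediate value argument, run backwards from the end of the walk. The empty walk
  -- is excluded since the hub has height 0.
  Crosses-spine : ∀ {k v} (w : Walk graph hub v) → toℕ k < height v →
    Crosses w (dart (spineEdge k))
  Crosses-spine {k} (_▹_ {v = u} w p) k<h = split (toℕ k <? height u)
    where
    split : Dec (toℕ k < height u) → Crosses (w ▹ p) (dart (spineEdge k))
    split (yes k<hu) = Crosses-step p (Crosses-spine w k<hu)
    split (no k≮hu)  = inj₁ (here (ends-injective graph (trans (ends-dart (spineEdge k))
      (height-crossing (nbr-linked u p) (≮⇒≥ k≮hu) k<h))))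

  adjacent : ∀ i → Adjacent (proj₁ (edge i)) (proj₂ (edge i))
  adjacent i = proj₂ (dart i) , cong proj₂ (ends-dart i)

  tip-or-below : ∀ k → k ≡ fromℕ d ⊎ toℕ k ≤ d₁
  tip-or-below k with m≤n⇒m<n∨m≡n (s≤s⁻¹ (toℕ<n k))
  ... | inj₁ (s≤s k≤d₁) = inj₂ k≤d₁
  ... | inj₂ k≡d        = inj₁ (toℕ-injective (trans k≡d (sym (toℕ-fromℕ d))))

  -- The two components put every node and every edge into the ball of radius `d`, so its counts are
  -- those of the whole graph.
  GoodBall : (G : Graph) → Graph.Node G → Set
  GoodBall G s = Radius G s d × (∀ v p → Distance< G s d v ⊎ Distance< G s d (Graph.target G v p))

  -- `ι` is `id` for the broom and `just` for its subdivisions, which leave the spine intact.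
  module SpineDistances (G : Graph) (ι : V → Graph.Node G)
    (adjacent-ι : ∀ k → Graph.Adjacent G (ι (spine (inject₁ k))) (ι (spine (suc k)))) where
    open Distances G (ι hub)

    spine-distance : ∀ k → Distance≤ G (ι hub) (toℕ k) (ι (spine k))
    spine-distance = <-weakInduction (λ k → Distance≤ G (ι hub) (toℕ k) (ι (spine k)))
      (Distance≤-source 0)
      (λ k dist → Distance≤-step (ι (spine (inject₁ k))) (ι (spine (suc k)))
        (subst (λ n → Distance≤ G (ι hub) n (ι (spine (inject₁ k)))) (toℕ-inject₁ k) dist)
        (adjacent-ι k))

    within-tip : Distance≤ G (ι hub) d (ι tip)
    within-tip =
      subst (λ n → Distance≤ G (ι hub) n (ι tip)) (toℕ-fromℕ d) (spine-distance (fromℕ d))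

    near-spine : ∀ k → ι (spine k) ≡ ι tip ⊎ Distance≤ G (ι hub) d₁ (ι (spine k))
    near-spine k with tip-or-below k
    ... | inj₁ refl = inj₁ refl
    ... | inj₂ k≤d₁ = inj₂ (Distance≤-mono k≤d₁ (spine-distance k))

  good-ball : GoodBall graph hub
  -- Only the tip lies at distance `d`; the hub fills the second exceptional place by default.
  good-ball = radius-and-near-edges height refl height-step {b = hub}
    (toℕ-fromℕ d) (s≤s z≤n) near within-tip (Distance≤-source d)
    where
    open Distances graph hub
    open SpineDistances graph id (λ k → adjacent (spineEdge k))
    near : ∀ v → v ≡ tip ⊎ v ≡ hub ⊎ Distance≤ graph hub d₁ v
    near (spine k)   = map₂ inj₂ (near-spine k)
    near (bristle y) = inj₂ (inj₂ (Distance≤-mono (s≤s z≤n)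
      (Distance≤-step hub (bristle y) (Distance≤-source 0) (adjacent (denseEdge (inj₁ y))))))

  dense-ends-low : ∀ j {u v} → (u , v) ≡ edge (denseEdge j) → height u ≡ 0 × height v ≡ 0
  dense-ends-low (inj₁ _) refl = refl , refl
  dense-ends-low (inj₂ _) refl = refl , refl

  -- Rules out that a spine edge, or a hub edge read backwards, is the subdivided one.
  dense-target : ∀ j {u k} → (u , spine k) ≢ edge (denseEdge j)
  dense-target (inj₁ _) ()
  dense-target (inj₂ _) ()

  module Subdivided (j : DenseEdge) where
    open Subdivision graph (suc nodeCount) label-bound (dart (denseEdge j)) public

    private
      low : height (proj₁ (ends graph (dart (denseEdge j)))) ≡ 0 ×
            height (proj₂ (ends graph (dart (denseEdge j)))) ≡ 0
      low = dense-ends-low j (ends-dart (denseEdge j))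

    tall : Node′ → ℕ
    tall = height′ height height-step (proj₁ low) (proj₂ low)

    tall-step : ∀ v p → tall (proj₁ (opp′ (v , p))) ≤ suc (tall v)
    tall-step = height′-step height height-step (proj₁ low) (proj₂ low)

    not-ends : ∀ {x} → x ≢ edge (denseEdge j) → x ≢ ends graph (dart (denseEdge j))
    not-ends ne eq = ne (trans eq (ends-dart (denseEdge j)))

    spine-adjacent : ∀ k → Adjacent′ (just (spine (inject₁ k))) (just (spine (suc k)))
    spine-adjacent k = Adjacent-lift (spine (inject₁ k)) (spine (suc k)) (adjacent (spineEdge k))
      (not-ends (dense-target j)) (not-ends (dense-target j))

    open Distances subdivided (just hub) public
    open SpineDistances subdivided just spine-adjacent public

    bristle-distance : ∀ y → edge (denseEdge (inj₁ y)) ≢ edge (denseEdge j) →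
      Distance≤ subdivided (just hub) 1 (just (bristle y))
    bristle-distance y ne = Distance≤-step (just hub) (just (bristle y)) (Distance≤-source 0)
      (Adjacent-lift hub (bristle y) (adjacent (denseEdge (inj₁ y)))
        (not-ends ne) (not-ends (dense-target j)))

    -- Subdivision moves a single node `b` of the dense part beyond distance 1. For `d = 2` this
    -- node may be as far as the tip, hence the exception made for it.
    ball : ∀ b → tall b < d₁ → Distance≤ subdivided (just hub) d b →
      Distance≤ subdivided (just hub) 1 nothing ⊎ nothing ≡ b →
      (∀ y → just (bristle y) ≡ b ⊎ Distance≤ subdivided (just hub) 1 (just (bristle y))) →
      GoodBall subdivided (just hub)
    ball b low-b within-b at-new at-bristle =
      radius-and-near-edges tall refl tall-step (toℕ-fromℕ d) low-b near within-tip within-b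
      where
      near : ∀ v → v ≡ just tip ⊎ v ≡ b ⊎ Distance≤ subdivided (just hub) d₁ v
      near nothing = inj₂ ([ inj₂ ∘ Distance≤-mono (s≤s z≤n) , inj₁ ]′ at-new)
      near (just (spine k)) = map₂ inj₂ (near-spine k)
      near (just (bristle y)) = inj₂ (map₂ (Distance≤-mono (s≤s z≤n)) (at-bristle y))

  good-ball-subdivided : ∀ j → GoodBall (Subdivided.subdivided j) (just hub)
  -- The new node is adjacent to the hub; `x`, cut off from the hub, is reached through it at
  -- distance at most 2.
  good-ball-subdivided j@(inj₁ x) = ball (just (bristle x)) (s≤s z≤n)
    (Distance≤-mono (s≤s (s≤s z≤n)) (Distance≤-step nothing (just (bristle x)) at-new
      (suc zero , cong just (cong proj₂ (ends-dart (denseEdge j))))))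
    (inj₁ at-new)
    (λ y → at-bristle y (bristle y ≟ⱽ bristle x))
    where
    open Subdivided j
    at-new : Distance≤ subdivided (just hub) 1 nothing
    at-new = Distance≤-step (just hub) nothing (Distance≤-source 0) first-half
    at-bristle : ∀ y → Dec (bristle y ≡ bristle x) →
      just (bristle y) ≡ just (bristle x) ⊎ Distance≤ subdivided (just hub) 1 (just (bristle y))
    at-bristle y (yes eq) = inj₁ (cong just eq)
    at-bristle y (no ne)  = inj₂ (bristle-distance y (ne ∘ cong proj₂))
  -- All bristles stay adjacent to the hub, and the new node lies one step beyond them.
  good-ball-subdivided j@(inj₂ (i , k)) = ball nothing (s≤s z≤n)
    (Distance≤-mono (s≤s (s≤s z≤n))
      (Distance≤-step (just (bristle (inj₁ i))) nothing (at-bristle (inj₁ i)) first-half))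
    (inj₂ refl) (inj₂ ∘ at-bristle)
    where
    open Subdivided j
    at-bristle : ∀ y → Distance≤ subdivided (just hub) 1 (just (bristle y))
    at-bristle y = bristle-distance y λ ()

  -- The adversary's choice among all hunts

  module Adversary (M : Model) (A : Algorithm) (hunt : IsTreasureHunt M A) where

    inModel : ∀ {G n} → Fin n ↔ Graph.Node G → InModel M G
    inModel F = finite⇒InModel M (_ , universal-cardinality F (λ _ → tt))

    -- `nothing` stands for the treasure at the tip of the broom itself, `just j` for the treasure
    -- in the node subdividing `j`.
    CostOf : Maybe DenseEdge → ℕ → Set
    CostOf nothing  = Cost A graph hub tip
    CostOf (just j) = Cost A (Subdivided.subdivided j) (just hub) nothing

    Covers : Maybe DenseEdge → ∀ {v} → Walk graph hub v → Set
    Covers nothing  w = ∀ k → Crosses w (dart (spineEdge k))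
    Covers (just j) w = Crosses w (dart (denseEdge j))

    -- Every hunt is recorded as a walk in the one graph `graph`, so that runs can be compared;
    -- `cost` remembers that a hunt in the graph of `t` has the same length.
    record Run (t : Maybe DenseEdge) : Set where
      field
        {end}   : V
        walk    : Walk graph hub end
        follows : Follows A walk
        covers  : Covers t walk
        cost    : CostOf t (steps walk)
    open Run

    run-tip : (w : Walk graph hub tip) → Finds A tip w → Run nothing
    run-tip w (fw , first) = record
      { walk    = w
      ; follows = fw
      ; covers  = λ k → Crosses-spine w (subst (toℕ k <_) (sym (toℕ-fromℕ d)) (toℕ<n k))
      ; cost    = w , (fw , first) , refl
      }

    run-subdivided : ∀ j (w′ : Walk (Subdivided.subdivided j) (just hub) nothing) →
      Finds A nothing w′ → Run (just j)
    run-subdivided j w′ (fw′ , first) =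
      let _ , w , steps-≡ , fw , crosses = Subdivided.project-hunt j w′ refl fw′ first in record
      { walk    = w
      ; follows = fw
      ; covers  = crosses
      ; cost    = w′ , (fw′ , first) , sym steps-≡
      }

    run : ∀ t → Run t
    run nothing  = let w , finds , _ = hunt graph (inModel V↔) hub tip in run-tip w finds
    run (just j) =
      let w′ , finds , _ = hunt (Subdivided.subdivided j) (inModel (Maybe↔ V↔)) (just hub) nothing
      in run-subdivided j w′ finds

    tests : List (Maybe DenseEdge)
    tests = map just (elements DenseEdge↔)

    duration : Maybe DenseEdge → ℕ
    duration t = steps (walk (run t))

    longest : Maybe DenseEdge
    -- The default value `nothing` brings the tip hunt into the maximum.
    longest = argmax duration nothing tests

    duration≤longest : ∀ t → duration t ≤ duration longest
    duration≤longest nothing  = f[⊥]≤f[argmax] {f = duration} nothing tests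
    duration≤longest (just j) =
      All.lookup (f[xs]≤f[argmax] {f = duration} nothing tests)
        (∈-map⁺ just (∈-elements DenseEdge↔ j))

    longest-crosses : ∀ t {f} → Crosses (walk (run t)) f → Crosses (walk (run longest)) f
    longest-crosses t = Follows-prefix {A = A} (walk (run t)) (walk (run longest))
      (follows (run t)) (follows (run longest)) (duration≤longest t)

    longest-crosses-dart : ∀ i → Crosses (walk (run longest)) (dart i)
    longest-crosses-dart (spineEdge k) = longest-crosses nothing (covers (run nothing) k)
    longest-crosses-dart (denseEdge j) = longest-crosses (just j) (covers (run (just j)))

    longest-crosses-all : ∀ f → Oriented graph f → Crosses (walk (run longest)) f
    longest-crosses-all f o = let i , f≡ = oriented⇒dart f o in
      subst (Crosses (walk (run longest))) (sym f≡) (longest-crosses-dart i)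

    edgeCount≤longest : edgeCount ≤ duration longest
    edgeCount≤longest =
      crossing-all⇒≤ oriented-cardinality (walk (run longest)) longest-crosses-all

    HardInstance : Set₁
    HardInstance = Σ Graph λ G → Σ (Graph.Node G) λ s → InModel M G × Radius G s d ×
      (∃[ n ] ∃[ e ]
        HasCardinality (BallNode G s d) n × (nodeCount ≤ n × n ≤ suc nodeCount) ×
        HasCardinality (BallEdge G s d) e × (edgeCount ≤ e × e ≤ suc edgeCount) ×
        (∃[ τ ] ∃[ k ] Distance≤ G s d τ × Cost A G s τ k × e ∸ 1 ≤ k))

    hard : ∀ G s {n e k} τ → GoodBall G s → Fin n ↔ Graph.Node G →
      nodeCount ≤ n → n ≤ suc nodeCount →
      HasCardinality (Oriented G) e → edgeCount ≤ e → e ≤ suc edgeCount →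
      Cost A G s τ k → e ∸ 1 ≤ k → HardInstance
    hard G s τ (rad , near) F n≥ n≤ edges e≥ e≤ cost k≥ =
      G , s , inModel F , rad , _ , _ ,
      universal-cardinality F (proj₁ rad) , (n≥ , n≤) ,
      cardinality-cong (λ (v , p) o → o , near v p) (λ _ → proj₁) edges , (e≥ , e≤) ,
      τ , _ , proj₁ rad τ , cost , k≥

    hard-instance : HardInstance
    hard-instance = instance-for longest (cost (run longest)) edgeCount≤longest
      where
      instance-for : ∀ t {k} → CostOf t k → edgeCount ≤ k → HardInstance
      instance-for nothing c le =
        hard graph hub tip good-ball V↔ ≤-refl (n≤1+n _)
          oriented-cardinality ≤-refl (n≤1+n _) c (≤-trans (m∸n≤m edgeCount 1) le)
      -- Here lies the loss of 1: the graph has `suc edgeCount` edges, while the run is only known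
      -- to make `edgeCount` traversals.
      instance-for (just j) c le =
        hard (Subdivided.subdivided j) (just hub) nothing (good-ball-subdivided j) (Maybe↔ V↔)
          (n≤1+n _) ≤-refl
          (Subdivided.oriented-cardinality j (dart-oriented (denseEdge j)) oriented-cardinality)
          (n≤1+n _) ≤-refl c le

-- Here a bristles of the first kind and m of the second, with a = x / m, make
-- a m + a + m the order of x because x lies between a m and (a + 1) m.
module _ {d m x : ℕ} .{{_ : NonZero m}}
         (1<d : 1 < d) (d≤m : d ≤ m) (m≤x : m ≤ x) (x≤m² : x ≤ m ^ 2) where

  private
    a : ℕ
    a = x / m

    a*m≤x : a * m ≤ x
    a*m≤x = m/n*n≤m x m

    a≤m : a ≤ m
    -- `m ^ 2` unfolds to `m * (m * 1)`, which gives `a * m ≤ x ≤ m * m`.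
    a≤m = *-cancelʳ-≤ a m m (≤-trans a*m≤x (subst (λ n → x ≤ m * n) (*-identityʳ m) x≤m²))

    -- Source of the constant 5: the upper bounds `1 + 1 + d + a + m` on nodes and
    -- `1 + d + a + m + a * m` on edges have five summands, each at most `m` or `x` respectively.
    five : ∀ {p q r s t n} → p ≤ n → q ≤ n → r ≤ n → s ≤ n → t ≤ n →
      p + (q + (r + (s + t))) ≤ 5 * n
    five {n = n} p q r s t =
      +-mono-≤ p (+-mono-≤ q (+-mono-≤ r (+-mono-≤ s (≤-trans t (m≤m+n n 0)))))

    1≤m : 1 ≤ m
    1≤m = ≤-trans (<⇒≤ 1<d) d≤m

  nodes-≍ : ∀ {n} → suc d + (a + m) ≤ n → n ≤ suc (suc d + (a + m)) → n ≍[ 5 ] m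
  nodes-≍ {n} n≥ n≤ =
    ≤-trans n≤ (five {1} {1} 1≤m 1≤m d≤m a≤m ≤-refl) ,
    ≤-trans (≤-trans (≤-trans (m≤n+m m a) (m≤n+m (a + m) (suc d))) n≥) (m≤n*m n 5)

  edges-≍ : ∀ {e} → d + ((a + m) + a * m) ≤ e → e ≤ suc (d + ((a + m) + a * m)) → e ≍[ 5 ] x
  edges-≍ {e} e≥ e≤ =
    ≤-trans e≤ (≤-trans (≤-reflexive (cong (λ k → suc (d + k)) (+-assoc a m (a * m))))
      (five {1} (≤-trans 1≤m m≤x) (≤-trans d≤m m≤x) (≤-trans a≤m m≤x) m≤x a*m≤x)) ,
    ≤-trans (≤-trans (≤-trans x≤ (m≤n+m _ d)) e≥) (m≤n*m e 5)
    where
    open ≤-Reasoning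
    x≤ : x ≤ (a + m) + a * m
    x≤ = begin
      x                 ≡⟨ m≡m%n+[m/n]*n x m ⟩
      x % m + a * m     ≤⟨ +-monoˡ-≤ (a * m) (m%n≤n x m) ⟩
      m + a * m         ≤⟨ +-monoˡ-≤ (a * m) (m≤n+m m a) ⟩
      (a + m) + a * m   ∎

proposition2p1 : ∃[ c ] (∀ (M : Model) (A : Algorithm) → IsTreasureHunt M A →
    ∀ (d m x : ℕ) → 1 < d → d ≤ m → m ≤ x → x ≤ m ^ 2 →
    Σ Graph λ G → Σ (Graph.Node G) λ s →
    InModel M G × Radius G s d ×
    (∃[ n ] ∃[ e ]
    HasCardinality (BallNode G s d) n × n ≍[ c ] m ×
    HasCardinality (BallEdge G s d) e × e ≍[ c ] x ×
    (∃[ τ ] ∃[ k ]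
    Distance≤ G s d τ × Cost A G s τ k × e ∸ 1 ≤ k)))
proposition2p1 = 5 , main
  where
  main : ∀ M A → IsTreasureHunt M A → ∀ d m x → 1 < d → d ≤ m → m ≤ x → x ≤ m ^ 2 → _
  -- `1 < d` exposes `d₂`, and `d ≤ m` excludes `m = 0`, so the division by `m` is legitimate.
  main M A hunt (suc (suc d₂)) m@(suc _) x 1<d@(s≤s (s≤s _)) d≤m m≤x x≤m²
    with Broom.Adversary.hard-instance d₂ (x / m) m M A hunt
  ... | G , s , inM , rad , n , e , nodes , (n≥ , n≤) , edges , (e≥ , e≤) , hardness =
    G , s , inM , rad , n , e ,
    nodes , nodes-≍ 1<d d≤m m≤x x≤m² n≥ n≤ ,
    edges , edges-≍ 1<d d≤m m≤x x≤m² e≥ e≤ , hardness
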